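{- The relations $E^{\mathrm{ce}}_1$, $E^{\mathrm{ce}}_3$, $E^{\mathrm{ce}}_{\mathrm{set}}$, and $E^{\mathrm{ce}}_{\max}$ are pairwise incomparable under $\leq_{\mathrm{Learn}}$.
   Context: Fix a standard (acceptable) enumeration $(\varphi_e)_{e\in\omega}$ of the partial computable functions and let $W_e=\operatorname{dom}(\varphi_e)$. Write $e=^{\mathrm{ce}}e'$ iff $W_e=W_{e'}$. Fix a computable bijective pairing function $\langle\cdot,\cdot\rangle:\omega^2\to\omega$, and let $W_e^{[k]}=\{i\in\omega:\langle k,i\rangle\in W_e\}$ be the $k$-th column of $W_e$. Define the following equivalence relations on $\omega$ (all extend $=^{\mathrm{ce}}$): - $e\mathrel{E^{\mathrm{ce}}_1}e'$ iff $W_e^{[k]}=W_{e'}^{[k]}$ for all but finitely many $k$; - $e\mathrel{E^{\mathrm{ce}}_3}e'$ iff for every $k$ the symmetric difference $W_e^{[k]}\mathbin{\triangle}W_{e'}^{[k]}$ is finite; - $e\mathrel{E^{\mathrm{ce}}_{\mathrm{set}}}e'$ iff $\{W_e^{[k]}:k\in\omega\}=\{W_{e'}^{[k]}:k\in\omega\}$; - $e\mathrel{E^{\mathrm{ce}}_{\max}}e'$ iff $W_e=W_{e'}=\emptyset$, or $W_e$ and $W_{e'}$ are both infinite, or $W_e,W_{e'}$ are both finite nonempty and $\max W_e=\max W_{e'}$. An enumeration of a set $A$ is a surjection $\mu:\omega\to A$; $\mu[s]$ denotes the finite string $\mu(0),\dots,\mu(s-1)$. A learner is an arbitrary function $\mathbf{M}:\omega^{<\omega}\to\omega$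 (no effectivity is assumed). For an equivalence relation $E^{\mathrm{ce}}$ on $\omega$ extending $=^{\mathrm{ce}}$, a family $\mathfrak{K}$ of nonempty c.e. sets is $E^{\mathrm{ce}}$-learnable if there is a learner $\mathbf{M}$ such that for every $e$ with $W_e\in\mathfrak{K}$ and every enumeration $\mu$ of $W_e$ there is $i\in\omega$ with $i\mathrel{E^{\mathrm{ce}}}e$ and $\mathbf{M}(\mu[s])=i$ for all sufficiently large $s$. $E^{\mathrm{ce}}\leq_{\mathrm{Learn}}F^{\mathrm{ce}}$ means that every $E^{\mathrm{ce}}$-learnable family of nonempty c.e. sets is also $F^{\mathrm{ce}}$-learnable; two relations are incomparable if neither is $\leq_{\mathrm{Learn}}$ the other. -}

module Defs where

open import Data.Fin.Base using (Fin)
open import Data.List.Base using (List; applyUpTo)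
open import Data.List.Membership.Propositional using (_∈_)
open import Data.Nat.Base using (ℕ; zero; suc; _≤_; _<_; _≥_)
open import Data.Product.Base using (_×_; ∃; uncurry)
open import Data.Sum.Base using (_⊎_)
open import Data.Vec.Base using (Vec; []; _∷_; lookup)
open import Data.Vec.Relation.Binary.Pointwise.Inductive using (Pointwise)
open import Function.Bundles using (_⇔_)
open import Function.Definitions using (Bijective)
open import Level using (0ℓ)
import Level
open import Relation.Binary.Core using (Rel)
open import Relation.Binary.Definitions using (_Respects_)
open import Relation.Binary.PropositionalEquality.Core using (_≡_)
open import Relation.Nullary.Negation.Core using (¬_)
open import Relation.Unary using (Pred; _≐_; _∪_; _∖_; Empty; Satisfiable)

data Rec : ℕ → Set where
  zer  : Rec 0
  succ : Rec 1
  proj : ∀ {n} → Fin n → Rec n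
  comp : ∀ {m n} → Rec m → Vec (Rec n) m → Rec n
  prec : ∀ {n} → Rec n → Rec (suc (suc n)) → Rec (suc n)
  mini : ∀ {n} → Rec (suc n) → Rec n

infix 4 _[_]⇓_

-- c [ xs ]⇓ y : the partial function coded by c is defined at xs, with value y.
data _[_]⇓_ : ∀ {n} → Rec n → Vec ℕ n → ℕ → Set where
  zer⇓  : zer [ [] ]⇓ 0
  succ⇓ : ∀ {x} → succ [ x ∷ [] ]⇓ suc x
  proj⇓ : ∀ {n} {i : Fin n} {xs} → proj i [ xs ]⇓ lookup xs i
  comp⇓ : ∀ {m n} {f : Rec m} {gs : Vec (Rec n) m} {xs ys z} →
          Pointwise (λ g y → g [ xs ]⇓ y) gs ys → f [ ys ]⇓ z →
          comp f gs [ xs ]⇓ z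
  prec⇓zero : ∀ {n} {f : Rec n} {g xs y} →
              f [ xs ]⇓ y → prec f g [ 0 ∷ xs ]⇓ y
  prec⇓suc  : ∀ {n} {f : Rec n} {g xs k r y} →
              prec f g [ k ∷ xs ]⇓ r → g [ k ∷ r ∷ xs ]⇓ y →
              prec f g [ suc k ∷ xs ]⇓ y
  mini⇓ : ∀ {n} {f : Rec (suc n)} {xs y} →
          f [ y ∷ xs ]⇓ 0 →
          (∀ {z} → z < y → ∃ λ w → f [ z ∷ xs ]⇓ suc w) →
          mini f [ xs ]⇓ y

-- Partial functions are given by their graphs: φ e x y means φ_e(x) = y.
-- `universal` makes every φ e partial computable; conversely, `smn` applied
-- to a code that ignores its first argument shows that every unary partial
-- computable function is some φ e.
record AcceptableNumbering : Set₁ where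
  field
    φ         : ℕ → ℕ → ℕ → Set
    universal : ∃ λ (u : Rec 2) → ∀ e x y → φ e x y ⇔ u [ e ∷ x ∷ [] ]⇓ y
    smn       : ∀ (c : Rec 2) → ∃ λ (s : Rec 1) → ∃ λ (f : ℕ → ℕ) →
                (∀ e → s [ e ∷ [] ]⇓ f e) ×
                (∀ e x y → φ (f e) x y ⇔ c [ e ∷ x ∷ [] ]⇓ y)

  W : ℕ → Pred ℕ 0ℓ
  W e x = ∃ λ y → φ e x y

record ComputablePairing : Set where
  field
    ⟨_,_⟩      : ℕ → ℕ → ℕ
    computable : ∃ λ (p : Rec 2) → ∀ k i → p [ k ∷ i ∷ [] ]⇓ ⟨ k , i ⟩
    bijective  : Bijective _≡_ _≡_ (uncurry ⟨_,_⟩)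

Finite : Pred ℕ 0ℓ → Set
Finite A = ∃ λ (xs : List ℕ) → A ≐ (_∈ xs)

Infinite : Pred ℕ 0ℓ → Set
Infinite A = ¬ Finite A

_△_ : Pred ℕ 0ℓ → Pred ℕ 0ℓ → Pred ℕ 0ℓ
A △ B = (A ∖ B) ∪ (B ∖ A)

IsMax : Pred ℕ 0ℓ → ℕ → Set
IsMax A m = A m × (∀ x → A x → x ≤ m)

module _ (N : AcceptableNumbering) where
  open AcceptableNumbering N

  module _ (P : ComputablePairing) where
    open ComputablePairing P

    column : ℕ → ℕ → Pred ℕ 0ℓ
    column e k i = W e ⟨ k , i ⟩

    E₁ : Rel ℕ 0ℓ
    E₁ e e′ = Finite (λ k → ¬ (column e k ≐ column e′ k))

    E₃ : Rel ℕ 0ℓ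
    E₃ e e′ = ∀ k → Finite (column e k △ column e′ k)

    Eset : Rel ℕ 0ℓ
    Eset e e′ = (∀ k → ∃ λ k′ → column e k ≐ column e′ k′)
              × (∀ k′ → ∃ λ k → column e k ≐ column e′ k′)

  -- In the last disjunct, the existence of a maximum entails nonemptiness.
  Emax : Rel ℕ 0ℓ
  Emax e e′ = (Empty (W e) × Empty (W e′))
            ⊎ (Infinite (W e) × Infinite (W e′))
            ⊎ (Finite (W e) × Finite (W e′) ×
               ∃ λ m → IsMax (W e) m × IsMax (W e′) m)

  -- Sets are predicates up to ≐, hence the closure condition `resp`.
  record Family : Set₁ where
    field
      Member   : Pred (Pred ℕ 0ℓ) 0ℓ
      resp     : Member Respects _≐_
      ce       : ∀ {A} → Member A → ∃ λ e → A ≐ W e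
      nonempty : ∀ {A} → Member A → Satisfiable A

  Enumerates : (ℕ → ℕ) → Pred ℕ 0ℓ → Set
  Enumerates μ A = (∀ s → A (μ s)) × (∀ x → A x → ∃ λ s → μ s ≡ x)

  Learner : Set
  Learner = List ℕ → ℕ

  Learnable : Rel ℕ 0ℓ → Family → Set
  Learnable E 𝔎 = ∃ λ (M : Learner) →
    ∀ e → Family.Member 𝔎 (W e) → ∀ μ → Enumerates μ (W e) →
    ∃ λ i → E i e × (∃ λ s₀ → ∀ s → s ≥ s₀ → M (applyUpTo μ s) ≡ i)

  _≤Learn_ : Rel (Rel ℕ 0ℓ) (Level.suc 0ℓ)
  E ≤Learn F = ∀ (𝔎 : Family) → Learnable E 𝔎 → Learnable F 𝔎

  Incomparable : Rel (Rel ℕ 0ℓ) (Level.suc 0ℓ)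
  Incomparable E F = ¬ (E ≤Learn F) × ¬ (F ≤Learn E)

{-# OPTIONS --safe #-}
module Submission where

-- Each non-reduction E ≰ F is witnessed by a family {A} ∪ {Bₙ : n ∈ ω} in which
-- the Bₙ increase to A, all members are E-equivalent, and no Bₙ is F-equivalent
-- to A. A constant learner succeeds for E. For F, a learner shown a finite part
-- of A can always be driven off the class of A by going on with some Bₙ, so
-- infinitely many such excursions make up an enumeration of A on which it fails.
-- The families are
--   E₁   ≰ E₃, Eset, Emax : A = column 0,              Bₙ = {⟨ 0 , i ⟩ : i ≤ n}
--   E₃   ≰ E₁, Eset, Emax : A = {⟨ k , 0 ⟩ : k ∈ ω},   Bₙ = {⟨ k , 0 ⟩ : k ≤ n}
--   Eset ≰ E₁, E₃         : A = the columns k ≥ 1,     Bₙ = the columns 1 ≤ k ≤ n + 1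
--   Eset ≰ Emax           : A = {⟨ k , 0 ⟩ : k ≥ 1},   Bₙ = {⟨ k , 0 ⟩ : 1 ≤ k ≤ n + 1}
--   Emax ≰ E₁, E₃, Eset   : A = ω,                     Bₙ = the columns k ≤ n

open import Defs
open import Axiom.ExcludedMiddle using (ExcludedMiddle)
open import Data.Empty using (⊥-elim)
open import Data.Fin.Patterns using (0F; 1F; 2F; 3F)
open import Data.Nat.Base hiding (_≰_)
open import Data.Nat.Properties
open import Data.List.Base using (List; []; _∷_; _++_; length; map; filter; applyUpTo; upTo)
open import Data.List.Properties using (length-++; ++-assoc; ++-identityʳ; ∷-injective)
open import Data.List.Membership.Propositional using (_∈_)
open import Data.List.Membership.Propositional.Properties
  using (finite; ∈-map⁺; ∈-++⁺ˡ; ∈-++⁺ʳ; ∈-filter⁺; ∈-filter⁻; ∈-applyUpTo⁺; ∈-applyUpTo⁻; ∈-upTo⁺)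
open import Data.List.Relation.Unary.All as All using (All; []; _∷_)
import Data.List.Relation.Unary.All.Properties as All
open import Data.List.Relation.Unary.Any using (here)
open import Data.List.Relation.Unary.AllPairs using (AllPairs; []; _∷_)
open import Data.Product.Base using (_×_; _,_; ∃; ∃₂; proj₁; proj₂)
open import Data.Sum.Base using (_⊎_; inj₁; inj₂)
open import Data.Vec.Base using (Vec; []; _∷_; lookup)
open import Data.Vec.Relation.Binary.Pointwise.Inductive using (Pointwise; []; _∷_)
open import Function.Base using (_∘_; id)
open import Function.Bundles using (module Equivalence; mk↣)
open import Level using (0ℓ)
open import Relation.Binary.Construct.Add.Supremum.NonStrict _≤_ using (_≤⁺_; [_]; _≤⊤⁺; ≤⁺-dec)
open import Relation.Binary.Core using (Rel)
open import Relation.Binary.Definitions using (tri<; tri≈; tri>)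
open import Relation.Binary.PropositionalEquality hiding ([_])
open import Relation.Nullary.Negation.Core using (¬_; contradiction)
open import Relation.Nullary.Construct.Add.Supremum using (_⁺; [_]; ⊤⁺)
open import Relation.Nullary.Decidable.Core using (yes; no)
open import Relation.Unary using (Pred; _≐_; _⊆_; _∪_; Satisfiable)
open import Relation.Unary.Properties using (≐-sym; ≐-trans)

-- Determinism of evaluation and basic computable functions

mutual
  -- Needed in `zeros-ce` to identify the value 0 at which a search halts with the product that the
  -- search tests.
  ⇓-functional : ∀ {n} (c : Rec n) {xs y z} → c [ xs ]⇓ y → c [ xs ]⇓ z → y ≡ z
  ⇓-functional zer        zer⇓          zer⇓          = refl
  ⇓-functional succ       succ⇓         succ⇓         = refl
  ⇓-functional (proj i)   proj⇓         proj⇓         = refl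
  ⇓-functional (comp f gs) (comp⇓ ps p) (comp⇓ qs q)
    rewrite ⇓-functional* gs ps qs = ⇓-functional f p q
  ⇓-functional (prec f g) (prec⇓zero p) (prec⇓zero q) = ⇓-functional f p q
  ⇓-functional (prec f g) (prec⇓suc p p′) (prec⇓suc q q′)
    rewrite ⇓-functional (prec f g) p q = ⇓-functional g p′ q′
  ⇓-functional (mini f) {y = y} {z} (mini⇓ p p<) (mini⇓ q q<) with <-cmp y z
  -- The search that stops at z saw a positive value at y, where the other search found 0.
  ... | tri< y<z _ _ = contradiction (⇓-functional f p (proj₂ (q< y<z))) 0≢1+n
  ... | tri≈ _ y≡z _ = y≡z
  ... | tri> _ _ z<y = contradiction (⇓-functional f q (proj₂ (p< z<y))) 0≢1+n

  ⇓-functional* : ∀ {m n} (gs : Vec (Rec n) m) {xs ys zs} →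
    Pointwise (λ g y → g [ xs ]⇓ y) gs ys →
    Pointwise (λ g y → g [ xs ]⇓ y) gs zs → ys ≡ zs
  ⇓-functional* []       []       []       = refl
  ⇓-functional* (g ∷ gs) (p ∷ ps) (q ∷ qs) =
    cong₂ _∷_ (⇓-functional g p q) (⇓-functional* gs ps qs)

Computable : ∀ {n} → (Vec ℕ n → ℕ) → Set
Computable {n} f = ∃ λ (c : Rec n) → ∀ xs → c [ xs ]⇓ f xs

Computable₂ : (ℕ → ℕ → ℕ) → Set
Computable₂ f = Computable {2} λ xs → f (lookup xs 0F) (lookup xs 1F)

proj-computable : ∀ {n} i → Computable {n} (λ xs → lookup xs i)
proj-computable i = proj i , λ _ → proj⇓

const-computable : ∀ {n} m → Computable {n} (λ _ → m)
const-computable zero    = comp zer [] , λ _ → comp⇓ [] zer⇓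
const-computable (suc m) with c , c⇓ ← const-computable m =
  comp succ (c ∷ []) , λ xs → comp⇓ (c⇓ xs ∷ []) succ⇓

∘-computable : ∀ {n} {g : ℕ → ℕ → ℕ} {f₁ f₂ : Vec ℕ n → ℕ} → Computable₂ g →
  Computable f₁ → Computable f₂ → Computable (λ xs → g (f₁ xs) (f₂ xs))
∘-computable (c , c⇓) (c₁ , c₁⇓) (c₂ , c₂⇓) =
  comp c (c₁ ∷ c₂ ∷ []) , λ xs → comp⇓ (c₁⇓ xs ∷ c₂⇓ xs ∷ []) (c⇓ _)

+-computable : Computable₂ _+_
+-computable = c , λ { (m ∷ n ∷ []) → c⇓ m n }
  where
  c = prec (proj 0F) (comp succ (proj 1F ∷ []))
  c⇓ : ∀ m n → c [ m ∷ n ∷ [] ]⇓ m + n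
  c⇓ zero    n = prec⇓zero proj⇓
  c⇓ (suc m) n = prec⇓suc (c⇓ m n) (comp⇓ (proj⇓ ∷ []) succ⇓)

*-computable : Computable₂ _*_
*-computable = c , λ { (m ∷ n ∷ []) → c⇓ m n }
  where
  base = const-computable 0
  step = ∘-computable {g = _+_} +-computable (proj-computable 2F) (proj-computable 1F)
  c = prec (proj₁ base) (proj₁ step)
  c⇓ : ∀ m n → c [ m ∷ n ∷ [] ]⇓ m * n
  c⇓ zero    n = prec⇓zero (proj₂ base _)
  c⇓ (suc m) n = prec⇓suc (c⇓ m n) (proj₂ step _)

-- Truncated subtraction iterates the predecessor along its second argument, while `prec` recurses
-- on the first, so the code is built for the swapped function.
∸-computable : Computable₂ _∸_
∸-computable = ∘-computable {g = λ n m → m ∸ n} (c , λ { (n ∷ m ∷ []) → c⇓ n m })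
                 (proj-computable 1F) (proj-computable 0F)
  where
  predecessor : Rec 1
  predecessor = prec zer (proj 0F)
  predecessor⇓ : ∀ m → predecessor [ m ∷ [] ]⇓ pred m
  predecessor⇓ zero    = prec⇓zero zer⇓
  predecessor⇓ (suc m) = prec⇓suc (predecessor⇓ m) proj⇓
  c = prec (proj 0F) (comp predecessor (proj 1F ∷ []))
  c⇓ : ∀ n m → c [ n ∷ m ∷ [] ]⇓ m ∸ n
  c⇓ zero    m = prec⇓zero proj⇓
  c⇓ (suc n) m rewrite sym (pred[m∸n]≡m∸[1+n] m n) =
    prec⇓suc (c⇓ n m) (comp⇓ (proj⇓ ∷ []) (predecessor⇓ (m ∸ n)))

-- Turns equality into a computable test for the value 0.
distance : ℕ → ℕ → ℕ
distance m n = (m ∸ n) + (n ∸ m)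

distance-computable : Computable₂ distance
distance-computable = ∘-computable {g = _+_} +-computable ∸-computable
  (∘-computable {g = _∸_} ∸-computable (proj-computable 1F) (proj-computable 0F))

distance-refl : ∀ n → distance n n ≡ 0
distance-refl n rewrite n∸n≡0 n = refl

distance≡0⇒≡ : ∀ m n → distance m n ≡ 0 → m ≡ n
distance≡0⇒≡ m n d≡0 = ≤-antisym (m∸n≡0⇒m≤n (m+n≡0⇒m≡0 (m ∸ n) d≡0))
                                 (m∸n≡0⇒m≤n (m+n≡0⇒n≡0 (m ∸ n) d≡0))

-- A bounded existential quantifier in arithmetic form: the product vanishes exactly when some
-- factor does.
∏ : (ℕ → ℕ) → ℕ → ℕ
∏ f zero    = 1
∏ f (suc n) = ∏ f n * f n

∏≡0⇒ : ∀ f n → ∏ f n ≡ 0 → ∃ λ k → f k ≡ 0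
∏≡0⇒ f (suc n) eq with m*n≡0⇒m≡0∨n≡0 (∏ f n) eq
... | inj₁ ∏≡0 = ∏≡0⇒ f n ∏≡0
... | inj₂ f≡0 = n , f≡0

∏≡0⇐ : ∀ f {n k} → k < n → f k ≡ 0 → ∏ f n ≡ 0
∏≡0⇐ f {suc n} {k} k<1+n f≡0 with m≤n⇒m<n∨m≡n (s≤s⁻¹ k<1+n)
... | inj₁ k<n  rewrite ∏≡0⇐ f k<n f≡0 = refl
... | inj₂ refl rewrite f≡0 = *-zeroʳ (∏ f k)

-- Supplies both premises of `mini⇓`: a zero, and explicit positive values below it.
least-zero : ∀ (f : ℕ → ℕ) n → f n ≡ 0 →
  ∃ λ m → f m ≡ 0 × (∀ {k} → k < m → ∃ λ w → f k ≡ suc w)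
least-zero f n fn≡0 with f 0 in eq
... | zero = 0 , eq , λ ()
least-zero f zero    fn≡0 | suc w = contradiction (trans (sym fn≡0) eq) 0≢1+n
least-zero f (suc n) fn≡0 | suc w with m , fm≡0 , below ← least-zero (f ∘ suc) n fn≡0 =
  suc m , fm≡0 , λ { {zero} _ → w , eq ; {suc k} k<m → below (s≤s⁻¹ k<m) }

-- Zero sets of computable functions are c.e.

module _ (N : AcceptableNumbering) (P : ComputablePairing) where
  open AcceptableNumbering N
  open ComputablePairing P

  pairing-computable : Computable₂ ⟨_,_⟩
  pairing-computable with c , c⇓ ← computable = c , λ { (k ∷ i ∷ []) → c⇓ k i }

  pairing-injective : ∀ {k i k′ i′} → ⟨ k , i ⟩ ≡ ⟨ k′ , i′ ⟩ → (k , i) ≡ (k′ , i′)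
  pairing-injective = proj₁ bijective

  -- The code given to `smn` searches for a pair that codes the input and at which ρ vanishes; the
  -- pairing function is thus inverted by search.
  zeros-ce : ∀ {ρ} → Computable₂ ρ →
    ∃ λ e → ∀ k → column N P e k ≐ (λ i → ρ k i ≡ 0)
  zeros-ce {ρ} ρ-computable = f 0 , λ k → sound k , complete k
    where
    -- The pairs are searched along the antidiagonals k + i = t.
    factor : ℕ → ℕ → ℕ → ℕ
    factor t x k = ρ k (t ∸ k) + distance ⟨ k , t ∸ k ⟩ x

    factor-computable : Computable {4} λ xs → factor (lookup xs 2F) (lookup xs 3F) (lookup xs 0F)
    factor-computable =
      ∘-computable {g = _+_} +-computable
        (∘-computable {g = ρ} ρ-computable k rest)
        (∘-computable {g = distance} distance-computable
          (∘-computable {g = ⟨_,_⟩} pairing-computable k rest) (proj-computable 3F))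
      where
      k    = proj-computable 0F
      rest = ∘-computable {g = _∸_} ∸-computable (proj-computable 2F) k

    product-step = ∘-computable {g = _*_} *-computable (proj-computable 1F) factor-computable

    product : Rec 3
    product = prec (proj₁ (const-computable 1)) (proj₁ product-step)

    product⇓ : ∀ n t x → product [ n ∷ t ∷ x ∷ [] ]⇓ ∏ (factor t x) n
    product⇓ zero    t x = prec⇓zero (proj₂ (const-computable 1) _)
    product⇓ (suc n) t x = prec⇓suc (product⇓ n t x) (proj₂ product-step _)

    test : Rec 3
    -- The factors are those with k ≤ t, hence the bound t + 1.
    test = comp product (comp succ (proj 0F ∷ []) ∷ proj 0F ∷ proj 2F ∷ [])

    test⇓ : ∀ {t e x y} → ∏ (factor t x) (suc t) ≡ y → test [ t ∷ e ∷ x ∷ [] ]⇓ y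
    test⇓ {t} {x = x} refl =
      comp⇓ (comp⇓ (proj⇓ ∷ []) succ⇓ ∷ proj⇓ ∷ proj⇓ ∷ []) (product⇓ (suc t) t x)

    f = proj₁ (proj₂ (smn (mini test)))

    φf⇔ = proj₂ (proj₂ (proj₂ (smn (mini test)))) 0

    sound : ∀ k → column N P (f 0) k ⊆ (λ i → ρ k i ≡ 0)
    sound k {i} (t , φt) with mini⇓ p _ ← Equivalence.to (φf⇔ _ _) φt
      with k′ , eq ← ∏≡0⇒ (factor t ⟨ k , i ⟩) (suc t) (⇓-functional test (test⇓ refl) p)
      -- Both summands of a vanishing factor are 0: the distance identifies the pair found with k,
      -- i, and the other summand is then ρ k i.
      with refl ← pairing-injective
                    (distance≡0⇒≡ _ _ (m+n≡0⇒n≡0 (ρ k′ (t ∸ k′)) eq))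
      = m+n≡0⇒m≡0 _ eq

    factor≡0 : ∀ k i → ρ k i ≡ 0 → factor (k + i) ⟨ k , i ⟩ k ≡ 0
    factor≡0 k i ρ≡0 rewrite m+n∸m≡n k i | ρ≡0 = distance-refl ⟨ k , i ⟩

    complete : ∀ k → (λ i → ρ k i ≡ 0) ⊆ column N P (f 0) k
    complete k {i} ρ≡0
      -- The pair k, i lies on the antidiagonal k + i, so the search ends there at the latest.
      with t , found , below ← least-zero (λ t → ∏ (factor t ⟨ k , i ⟩) (suc t)) (k + i)
             (∏≡0⇐ (factor (k + i) ⟨ k , i ⟩) (s≤s (m≤m+n k i)) (factor≡0 k i ρ≡0))
      = t , Equivalence.from (φf⇔ _ _) 
          (mini⇓ (test⇓ found) λ z<t → proj₁ (below z<t) , test⇓ (proj₂ (below z<t)))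

  ⊆-on-pairs : ∀ {A B : Pred ℕ 0ℓ} → (∀ k i → A ⟨ k , i ⟩ → B ⟨ k , i ⟩) → A ⊆ B
  ⊆-on-pairs A⊆B {x} with (k , i) , ≡x ← proj₂ bijective x with refl ← ≡x refl = A⊆B k i

-- Infinite sequences as limits of growing strings

nth : List ℕ → ℕ → ℕ
nth []       _       = 0
nth (x ∷ xs) zero    = x
nth (x ∷ xs) (suc s) = nth xs s

nth-++ : ∀ xs {ys s} → s < length xs → nth (xs ++ ys) s ≡ nth xs s
nth-++ (x ∷ xs) {s = zero}  _   = refl
nth-++ (x ∷ xs) {s = suc s} s<l = nth-++ xs (s≤s⁻¹ s<l)

applyUpTo-nth : ∀ {f : ℕ → ℕ} xs → (∀ {s} → s < length xs → f s ≡ nth xs s) →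
  applyUpTo f (length xs) ≡ xs
applyUpTo-nth []       f≡ = refl
applyUpTo-nth (x ∷ xs) f≡ = cong₂ _∷_ (f≡ z<s) (applyUpTo-nth xs (f≡ ∘ s<s))

applyUpTo-prefix : ∀ (f : ℕ → ℕ) xs {ys} →
  applyUpTo f (length (xs ++ ys)) ≡ xs ++ ys → applyUpTo f (length xs) ≡ xs
applyUpTo-prefix f []       eq = refl
applyUpTo-prefix f (x ∷ xs) eq with p , q ← ∷-injective eq =
  cong₂ _∷_ p (applyUpTo-prefix (f ∘ suc) xs q)

module _ (σ : ℕ → List ℕ) (extends : ∀ n → ∃₂ λ x δ → σ (suc n) ≡ σ n ++ x ∷ δ) where

  -- Stage s + 1 has at least s + 1 entries (`n≤length`), so the default value of `nth` is never
  -- reached.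
  limit : ℕ → ℕ
  limit s = nth (σ (suc s)) s

  n≤length : ∀ n → n ≤ length (σ n)
  n≤length zero    = z≤n
  n≤length (suc n) with x , δ , eq ← extends n
    rewrite eq | length-++ (σ n) {x ∷ δ} | +-suc (length (σ n)) (length δ) =
    s≤s (≤-trans (n≤length n) (m≤m+n _ _))

  prefix : ∀ d n → ∃ λ δ → σ (d + n) ≡ σ n ++ δ
  prefix zero    n = [] , sym (++-identityʳ (σ n))
  prefix (suc d) n with δ , eq ← prefix d n with x , δ′ , eq′ ← extends (d + n) =
    δ ++ x ∷ δ′ , trans eq′ (trans (cong (_++ x ∷ δ′) eq) (++-assoc (σ n) δ (x ∷ δ′)))

  nth-stable : ∀ {m n s} → m ≤ n → s < length (σ m) → nth (σ n) s ≡ nth (σ m) s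
  nth-stable {m} {n} m≤n s<l with δ , eq ← prefix (n ∸ m) m
    rewrite m∸n+n≡m m≤n | eq = nth-++ (σ m) s<l

  applyUpTo-limit : ∀ n → applyUpTo limit (length (σ n)) ≡ σ n
  applyUpTo-limit n = applyUpTo-nth (σ n) agrees
    where
    agrees : ∀ {s} → s < length (σ n) → limit s ≡ nth (σ n) s
    agrees {s} s<l with ≤-total n (suc s)
    ... | inj₁ n≤1+s = nth-stable n≤1+s s<l
    ... | inj₂ 1+s≤n = sym (nth-stable 1+s≤n (n≤length (suc s)))

infixr 5 _⧺_

_⧺_ : List ℕ → (ℕ → ℕ) → ℕ → ℕ
([]      ⧺ μ) s       = μ s
((x ∷ σ) ⧺ μ) zero    = x
((x ∷ σ) ⧺ μ) (suc s) = (σ ⧺ μ) s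

applyUpTo-⧺ : ∀ σ μ s → applyUpTo (σ ⧺ μ) (length σ + s) ≡ σ ++ applyUpTo μ s
applyUpTo-⧺ []      μ s = refl
applyUpTo-⧺ (x ∷ σ) μ s = cong (x ∷_) (applyUpTo-⧺ σ μ s)

injective⇒infinite : ∀ {A} (f : ℕ → ℕ) → (∀ {s t} → f s ≡ f t → s ≡ t) →
  (∀ t → A (f t)) → Infinite A
injective⇒infinite f f-injective Af (xs , A⊆xs , _) =
  finite (mk↣ f-injective) xs (A⊆xs ∘ Af)

-- Enumerations with infinitely many detours

module _ (N : AcceptableNumbering) where
  open AcceptableNumbering N

  ⧺-enumerates : ∀ {σ μ A} → All A σ → Enumerates N μ A → Enumerates N (σ ⧺ μ) A
  ⧺-enumerates []                        μ-enum = μ-enum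
  ⧺-enumerates {x ∷ σ} {μ} {A} (Ax ∷ Aσ) μ-enum with σμ-in , σμ-onto ← ⧺-enumerates Aσ μ-enum =
    (λ { zero → Ax ; (suc s) → σμ-in s }) ,
    (λ y Ay → let s , eq = σμ-onto y Ay in suc s , eq)

  -- Stage n + 1 of the enumeration prolongs stage n by a detour into Q and
  -- then appends α n.
  enumeration-meeting : ∀ {A : Pred ℕ 0ℓ} {Q : Pred (List ℕ) 0ℓ} {α} → Enumerates N α A →
    (∀ {σ} → All A σ → ∃ λ τ → All A τ × Q (σ ++ τ)) →
    ∃ λ μ → Enumerates N μ A × (∀ n → ∃ λ s → s ≥ n × Q (applyUpTo μ s))
  enumeration-meeting {A} {Q} {α} (α-in , α-onto) detour = μ , (μ-in , μ-onto) , meets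
    where
    stage : ℕ → ∃ (All A)
    stage zero    = [] , []
    stage (suc n) with σ , Aσ ← stage n with τ , Aτ , _ ← detour Aσ =
      σ ++ τ ++ α n ∷ [] , All.++⁺ Aσ (All.++⁺ Aτ (α-in n ∷ []))

    σ τ : ℕ → List ℕ
    σ n = proj₁ (stage n)
    τ n = proj₁ (detour (proj₂ (stage n)))

    extends : ∀ n → ∃₂ λ x δ → σ (suc n) ≡ σ n ++ x ∷ δ
    -- The detour may be empty; the entry α n makes the stage grow in either case.
    extends n with τ n
    ... | []    = α n , [] , refl
    ... | x ∷ δ = x , δ ++ α n ∷ [] , refl

    μ = limit σ extends

    μ-σ : ∀ n → applyUpTo μ (length (σ n)) ≡ σ n
    μ-σ = applyUpTo-limit σ extends

    μ-in : ∀ s → A (μ s)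
    μ-in s = All.lookup (proj₂ (stage (suc s)))
      (subst (μ s ∈_) (μ-σ (suc s)) (∈-applyUpTo⁺ μ (n≤length σ extends (suc s))))

    μ-onto : ∀ x → A x → ∃ λ s → μ s ≡ x
    μ-onto x Ax with t , refl ← α-onto x Ax
      with s , _ , eq ← ∈-applyUpTo⁻ μ (subst (α t ∈_) (sym (μ-σ (suc t)))
             (∈-++⁺ʳ (σ t) (∈-++⁺ʳ (τ t) (here refl)))) = s , sym eq

    meets : ∀ n → ∃ λ s → s ≥ n × Q (applyUpTo μ s)
    meets n = length (σ n ++ τ n) ,
      subst (n ≤_) (sym (length-++ (σ n))) (≤-trans (n≤length σ extends n) (m≤m+n _ _)) ,
      -- Q holds at stage n + 1 without its last entry α n, which is still an initial segment of μ.
      subst Q (sym (applyUpTo-prefix μ (σ n ++ τ n) σ++τ-prefix))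
        (proj₂ (proj₂ (detour (proj₂ (stage n)))))
      where
      σ++τ-prefix : applyUpTo μ (length ((σ n ++ τ n) ++ α n ∷ [])) ≡ (σ n ++ τ n) ++ α n ∷ []
      σ++τ-prefix = subst (λ xs → applyUpTo μ (length xs) ≡ xs)
        (sym (++-assoc (σ n) (τ n) (α n ∷ []))) (μ-σ (suc n))

  Emax-finite⇒ : ∀ {i e} → Emax N i e → Finite (W i) → Finite (W e)
  Emax-finite⇒ (inj₁ (_ , ∅))                  _   = [] , (λ {x} We → contradiction We (∅ x)) , λ ()
  Emax-finite⇒ (inj₂ (inj₁ (inf , _)))         fin = contradiction fin inf
  Emax-finite⇒ (inj₂ (inj₂ (_ , fin , _)))     _   = fin

  Emax-finite⇐ : ∀ {i e} → Emax N i e → Finite (W e) → Finite (W i)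
  Emax-finite⇐ (inj₁ (∅ , _))                  _   = [] , (λ {x} Wi → contradiction Wi (∅ x)) , λ ()
  Emax-finite⇐ (inj₂ (inj₁ (_ , inf)))         fin = contradiction fin inf
  Emax-finite⇐ (inj₂ (inj₂ (fin , _)))         _   = fin

-- Finiteness and the criterion for non-learnability

module _ (em : ExcludedMiddle 0ℓ) where

  -- `Finite` asks for an exact list, so the covering list is filtered by membership in A, which
  -- excluded middle decides.
  finite-⊆ : ∀ {A} xs → A ⊆ (_∈ xs) → Finite A
  finite-⊆ {A} xs A⊆xs = filter A? xs , (λ Ax → ∈-filter⁺ A? (A⊆xs Ax) Ax)
                                      , (λ x∈ → proj₂ (∈-filter⁻ A? {xs = xs} x∈))
    where
    A? = λ x → em {A x}

  finite-∪ : ∀ {A B C : Pred ℕ 0ℓ} → Finite A → Finite B → C ⊆ A ∪ B → Finite C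
  finite-∪ {C = C} (xs , A⊆xs , _) (ys , B⊆ys , _) C⊆ = finite-⊆ (xs ++ ys) (C⊆xs++ys ∘ C⊆)
    where
    C⊆xs++ys : ∀ {x} → _ → x ∈ xs ++ ys
    C⊆xs++ys (inj₁ Ax) = ∈-++⁺ˡ (A⊆xs Ax)
    C⊆xs++ys (inj₂ Bx) = ∈-++⁺ʳ xs (B⊆ys Bx)

  module _ (N : AcceptableNumbering) where
    open AcceptableNumbering N

    enumeration : ∀ {A} → Satisfiable A → ∃ λ μ → Enumerates N μ A
    enumeration {A} (x₀ , Ax₀) = μ , inA , onto
      where
      μ : ℕ → ℕ
      μ s with em {A s}
      ... | yes _ = s
      -- Positions outside A repeat the known element x₀.
      ... | no  _ = x₀
      inA : ∀ s → A (μ s)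
      inA s with em {A s}
      ... | yes As = As
      ... | no  _  = Ax₀
      onto : ∀ x → A x → ∃ λ s → μ s ≡ x
      onto x Ax = x , μx≡x
        where
        μx≡x : μ x ≡ x
        μx≡x with em {A x}
        ... | yes _  = refl
        ... | no ¬Ax = contradiction Ax ¬Ax

    module _ {F : Rel ℕ 0ℓ} (𝔎 : Family N) {a : ℕ}
             (approximated : ∀ {σ} → All (W a) σ → ∃ λ b → Family.Member 𝔎 (W b) ×
               W b ⊆ W a × All (W b) σ × (∀ {i} → F i a → ¬ F i b)) where

      -- Follow σ by an enumeration of some W b that contains σ. The learner must settle on an
      -- F-equivalent of b, and this cannot be F-related to a.
      detour : ((M , _) : Learnable N F 𝔎) → ∀ {σ} → All (W a) σ →
        ∃ λ τ → All (W a) τ × ¬ F (M (σ ++ τ)) a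
      detour (M , learns) {σ} Wσ
        with b , b∈𝔎 , b⊆a , Wbσ , separated ← approximated Wσ
        with β , β-enum ← enumeration (Family.nonempty 𝔎 b∈𝔎)
        with i , Fib , s₀ , stable ← learns b b∈𝔎 (σ ⧺ β) (⧺-enumerates N Wbσ β-enum) =
        applyUpTo β s₀ , All.applyUpTo⁺₂ β s₀ (λ s → b⊆a (proj₁ β-enum s)) ,
        λ Fa → separated (subst (λ j → F j a) M≡i Fa) Fib
        where
        M≡i : M (σ ++ applyUpTo β s₀) ≡ i
        M≡i = trans (cong M (sym (applyUpTo-⧺ σ β s₀))) (stable _ (m≤n+m s₀ (length σ)))

      -- Interleaving detours with an enumeration of W a gives an enumeration of W a along which the
      -- conjectures fail to be F-related to a infinitely often.
      not-learnable : Family.Member 𝔎 (W a) → ¬ Learnable N F 𝔎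
      not-learnable a∈𝔎 learnable@(M , learns) =
        refute (enumeration-meeting N {Q = λ σ → ¬ F (M σ) a}
          (proj₂ (enumeration (Family.nonempty 𝔎 a∈𝔎))) (detour learnable))
        where
        refute : ¬ (∃ λ μ → Enumerates N μ (W a) × (∀ n → ∃ λ s → s ≥ n × ¬ F (M (applyUpTo μ s)) a))
        refute (μ , μ-enum , off)
          with i , Fia , s₀ , stable ← learns a a∈𝔎 μ μ-enum
          with s , s₀≤s , ¬Fa ← off s₀ =
          ¬Fa (subst (λ j → F j a) (sym (stable s s₀≤s)) Fia)

-- Families of cuts and the separation criterion

0≤⁺ : ∀ c → [ 0 ] ≤⁺ c
0≤⁺ ⊤⁺    = _ ≤⊤⁺
0≤⁺ [ n ] = [ z≤n ]

-- The sets {⟨ k , i ⟩ : ρ k i ≡ 0 and κ k i ≤ c}: c = ⊤⁺ gives the limit set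
-- of the family, c ∈ ℕ an increasing sequence exhausting it.
record Shape : Set where
  field
    ρ κ          : ℕ → ℕ → ℕ
    ρ-computable : Computable₂ ρ
    κ-computable : Computable₂ κ
    inhabited    : ∃₂ λ k i → ρ k i ≡ 0 × κ k i ≡ 0

  Cut : ℕ ⁺ → ℕ → Pred ℕ 0ℓ
  Cut c k i = ρ k i ≡ 0 × [ κ k i ] ≤⁺ c

module _ (N : AcceptableNumbering) (P : ComputablePairing) where
  open AcceptableNumbering N
  open ComputablePairing P

  record IsCut (G : Shape) (c : ℕ ⁺) (A : Pred ℕ 0ℓ) : Set where
    constructor cut
    field at : ∀ k → (λ i → A ⟨ k , i ⟩) ≐ Shape.Cut G c k
  open IsCut public

  module _ (G : Shape) where
    open Shape G

    cut-ce : ∀ c → ∃ λ e → IsCut G c (W e)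
    cut-ce ⊤⁺ with e , col ← zeros-ce N P ρ-computable =
      e , cut λ k → (λ We → proj₁ (col k) We , (_ ≤⊤⁺)) , λ (ρ≡0 , _) → proj₂ (col k) ρ≡0
    -- ρ + (κ ∸ n) vanishes exactly when ρ = 0 and κ ≤ n.
    cut-ce [ n ] with e , col ← zeros-ce N P (∘-computable {g = _+_} +-computable ρ-computable
                       (∘-computable {g = _∸_} ∸-computable κ-computable (const-computable n))) =
      e , cut λ k →
        (λ {i} We → m+n≡0⇒m≡0 (ρ k i) (proj₁ (col k) We) ,
          [ m∸n≡0⇒m≤n (m+n≡0⇒n≡0 (ρ k i) (proj₁ (col k) We)) ]) ,
        λ { (ρ≡0 , [ κ≤n ]) → proj₂ (col k) (cong₂ _+_ ρ≡0 (m≤n⇒m∸n≡0 κ≤n)) }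

    cuts : Family N
    cuts = record
      { Member   = λ A → ∃ λ c → IsCut G c A
      ; resp     = λ { (A⊆B , B⊆A) (c , A-cut) → c , cut λ k →
                     (λ Bi → proj₁ (at A-cut k) (B⊆A Bi)) , λ Gi → A⊆B (proj₂ (at A-cut k) Gi) }
      ; ce       = λ { {A} (c , A-cut) → let e , W-cut = cut-ce c in e ,
                     ⊆-on-pairs N P {A} {W e} (λ k i Ai → proj₂ (at W-cut k) (proj₁ (at A-cut k) Ai)) ,
                     ⊆-on-pairs N P {W e} {A} (λ k i Wi → proj₂ (at A-cut k) (proj₁ (at W-cut k) Wi)) }
      ; nonempty = λ { (c , A-cut) → let k , i , ρ≡0 , κ≡0 = inhabited in
                     ⟨ k , i ⟩ , proj₂ (at A-cut k) (ρ≡0 , subst (λ m → [ m ] ≤⁺ c) (sym κ≡0) (0≤⁺ c)) }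
      }
    -- The bound n is the maximum of the values of κ at the entries of σ.
    exhausted : ∀ {A σ} → IsCut G ⊤⁺ A → All A σ →
      ∃ λ n → ∀ {B m} → n ≤ m → IsCut G [ m ] B → All B σ
    exhausted                A-cut []       = 0 , λ _ _ → []
    exhausted {A} {σ = x ∷ σ} A-cut (Ax ∷ Aσ)
      with n , covers ← exhausted A-cut Aσ
      with (k , i) , ≡x ← proj₂ bijective x with refl ← ≡x refl =
      κ k i ⊔ n , λ κ⊔n≤m B-cut →
        proj₂ (at B-cut k) (proj₁ (proj₁ (at A-cut k) Ax) , [ m⊔n≤o⇒m≤o _ _ κ⊔n≤m ]) ∷
        covers (m⊔n≤o⇒n≤o (κ k i) _ κ⊔n≤m) B-cut

    -- The second hypothesis goes through a common i because F is an arbitrary relation, and the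
    -- learner's conjecture i is what gets compared with both a and b.
    cuts-separate : ExcludedMiddle 0ℓ → ∀ {E F : Rel ℕ 0ℓ} →
      (∀ {a e c} → IsCut G ⊤⁺ (W a) → IsCut G c (W e) → E a e) →
      (∀ {i a b n} → IsCut G ⊤⁺ (W a) → IsCut G [ n ] (W b) → F i a → ¬ F i b) →
      ¬ _≤Learn_ N E F
    cuts-separate em {F = F} E-equivalent F-inequivalent E≤F with a , a-cut ← cut-ce ⊤⁺ =
      not-learnable em N cuts approximated (⊤⁺ , a-cut)
        -- The constant learner a witnesses E-learnability, since every cut is E-equivalent to the
        -- limit set.
        (E≤F cuts ((λ _ → a) , λ e (c , e-cut) _ _ → a , E-equivalent a-cut e-cut , 0 , λ _ _ → refl))
      where
      approximated : ∀ {σ} → All (W a) σ → ∃ λ b → Family.Member cuts (W b) × W b ⊆ W a ×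
        All (W b) σ × (∀ {i} → F i a → ¬ F i b)
      approximated Wσ with n , covers ← exhausted a-cut Wσ with b , b-cut ← cut-ce [ n ] =
        b , ([ n ] , b-cut) ,
        ⊆-on-pairs N P {W b} {W a}
          (λ k i Wb → proj₂ (at a-cut k) (proj₁ (proj₁ (at b-cut k) Wb) , (_ ≤⊤⁺))) ,
        covers ≤-refl b-cut , F-inequivalent a-cut b-cut

  -- Reduces the second hypothesis of `cuts-separate` to showing that a and b themselves are not
  -- equivalent.
  Eset-euclidean : ∀ {i a b} → Eset N P i a → Eset N P i b → Eset N P a b
  Eset-euclidean (i→a , a→i) (i→b , b→i) =
    (λ k → let k′ , i≐a = a→i k ; k″ , i≐b = i→b k′ in k″ , ≐-trans (≐-sym i≐a) i≐b) ,
    (λ k → let k′ , i≐b = b→i k ; k″ , i≐a = i→a k′ in k″ , ≐-trans (≐-sym i≐a) i≐b)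

  module _ (em : ExcludedMiddle 0ℓ) where

    -- Where a and b disagree, i disagrees with one of them. `E₃-euclidean` uses this element by
    -- element within each column.
    E₁-euclidean : ∀ {i a b} → E₁ N P i a → E₁ N P i b → E₁ N P a b
    E₁-euclidean {i} {a} {b} E-ia E-ib = finite-∪ em E-ia E-ib differ
      where
      differ : ∀ {k} → ¬ (column N P a k ≐ column N P b k) →
        ¬ (column N P i k ≐ column N P a k) ⊎ ¬ (column N P i k ≐ column N P b k)
      differ {k} a≠b with em {column N P i k ≐ column N P a k}
      ... | no  i≠a = inj₁ i≠a
      ... | yes i≐a = inj₂ λ i≐b → a≠b (≐-trans (≐-sym i≐a) i≐b)

    E₃-euclidean : ∀ {i a b} → E₃ N P i a → E₃ N P i b → E₃ N P a b
    E₃-euclidean {i} {a} {b} E-ia E-ib k = finite-∪ em (E-ia k) (E-ib k) differ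
      where
      differ : (column N P a k △ column N P b k) ⊆
        (column N P i k △ column N P a k) ∪ (column N P i k △ column N P b k)
      differ {x} (inj₁ (x∈a , x∉b)) with em {column N P i k x}
      ... | yes x∈i = inj₂ (inj₁ (x∈i , x∉b))
      ... | no  x∉i = inj₁ (inj₂ (x∈a , x∉i))
      differ {x} (inj₂ (x∈b , x∉a)) with em {column N P i k x}
      ... | yes x∈i = inj₁ (inj₁ (x∈i , x∉a))
      ... | no  x∉i = inj₂ (inj₂ (x∈b , x∉i))

-- The concrete families and their equivalences

horizontal : Shape
horizontal = record
  { ρ = λ k i → k ; κ = λ k i → i
  ; ρ-computable = proj-computable 0F ; κ-computable = proj-computable 1F
  ; inhabited = 0 , 0 , refl , refl
  }

-- Column k is empty for k < s; every later column is ω if z = 0 and {0} if z = 1.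
vertical : ℕ → ℕ → Shape
vertical s z = record
  { ρ = λ k i → (s ∸ k) + z * i ; κ = λ k i → k ∸ s
  ; ρ-computable = ∘-computable {g = _+_} +-computable
      (∘-computable {g = _∸_} ∸-computable (const-computable s) (proj-computable 0F))
      (∘-computable {g = _*_} *-computable (const-computable z) (proj-computable 1F))
  ; κ-computable = ∘-computable {g = _∸_} ∸-computable (proj-computable 0F) (const-computable s)
  ; inhabited = s , 0 , cong₂ _+_ (n∸n≡0 s) (*-zeroʳ z) , n∸n≡0 s
  }

module _ (em : ExcludedMiddle 0ℓ) (N : AcceptableNumbering) (P : ComputablePairing) where
  open AcceptableNumbering N
  open ComputablePairing P

  row-injective : ∀ {i s t} → ⟨ s , i ⟩ ≡ ⟨ t , i ⟩ → s ≡ t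
  row-injective = cong proj₁ ∘ pairing-injective N P

  column-injective : ∀ {k s t} → ⟨ k , s ⟩ ≡ ⟨ k , t ⟩ → s ≡ t
  column-injective = cong proj₂ ∘ pairing-injective N P

  -- Finiteness would pass from W b to W i and on to W a.
  Emax-separated : ∀ {i a b} → Infinite (W a) → Finite (W b) → Emax N i a → ¬ Emax N i b
  Emax-separated a-inf b-fin Eia Eib = a-inf (Emax-finite⇒ N Eia (Emax-finite⇐ N Eib b-fin))

  module Horizontal where

    -- All cuts are empty outside column 0, so no other column can differ.
    E₁-equivalent : ∀ {a e c} → IsCut N P horizontal ⊤⁺ (W a) → IsCut N P horizontal c (W e) →
      E₁ N P a e
    E₁-equivalent {a} {e} a-cut e-cut = finite-⊆ em (0 ∷ []) only-0
      where
      only-0 : ∀ {k} → ¬ (column N P a k ≐ column N P e k) → k ∈ 0 ∷ []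
      only-0 {zero}  _   = here refl
      only-0 {suc k} a≠e = ⊥-elim (a≠e
        ( (λ Wa → contradiction (proj₁ (proj₁ (at a-cut (suc k)) Wa)) 1+n≢0)
        , (λ We → contradiction (proj₁ (proj₁ (at e-cut (suc k)) We)) 1+n≢0)))

    module _ {b n} (b-cut : IsCut N P horizontal [ n ] (W b)) where

      not-in-b : ∀ {k i} → n < i → ¬ W b ⟨ k , i ⟩
      not-in-b {k} n<i Wb with _ , [ i≤n ] ← proj₁ (at b-cut k) Wb = <⇒≱ n<i i≤n

      b-finite : Finite (W b)
      b-finite = finite-⊆ em (map ⟨ 0 ,_⟩ (upTo (suc n))) (⊆-on-pairs N P {W b} listed)
        where
        listed : ∀ k i → W b ⟨ k , i ⟩ → ⟨ k , i ⟩ ∈ map ⟨ 0 ,_⟩ (upTo (suc n))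
        listed k i Wb with refl , [ i≤n ] ← proj₁ (at b-cut k) Wb = ∈-map⁺ _ (∈-upTo⁺ (s≤s i≤n))

    module _ {a} (a-cut : IsCut N P horizontal ⊤⁺ (W a)) where

      in-a : ∀ i → W a ⟨ 0 , i ⟩
      in-a i = proj₂ (at a-cut 0) (refl , (_ ≤⊤⁺))

      a-infinite : Infinite (W a)
      a-infinite = injective⇒infinite ⟨ 0 ,_⟩ column-injective in-a

      module _ {b n} (b-cut : IsCut N P horizontal [ n ] (W b)) where

        ¬E₃ : ¬ E₃ N P a b
        -- In column 0 the difference contains every i > n.
        ¬E₃ E = injective⇒infinite (suc n +_) (+-cancelˡ-≡ (suc n) _ _)
          (λ t → inj₁ (in-a _ , not-in-b b-cut (m≤m+n (suc n) t))) (E 0)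

        ¬Eset : ¬ Eset N P a b
        -- Column 0 of a is all of ω, while every column of b misses n + 1.
        ¬Eset (a→b , _) with k , a≐b ← a→b 0 =
          not-in-b b-cut (n<1+n n) (proj₁ a≐b (in-a (suc n)))

  module Vertical (s z : ℕ) where

    in-column : ∀ {c A k i} → IsCut N P (vertical s z) c A → s ≤ k → z * i ≡ 0 → [ k ∸ s ] ≤⁺ c →
      A ⟨ k , i ⟩
    in-column {k = k} A-cut s≤k zi≡0 k∸s≤c =
      proj₂ (at A-cut k) (cong₂ _+_ (m≤n⇒m∸n≡0 s≤k) zi≡0 , k∸s≤c)

    column-start : ∀ {c A k i} → IsCut N P (vertical s z) c A → A ⟨ k , i ⟩ → s ≤ k
    column-start {k = k} A-cut Aki = m∸n≡0⇒m≤n (m+n≡0⇒m≡0 (s ∸ k) (proj₁ (proj₁ (at A-cut k) Aki)))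

    column-content : ∀ {c A k i} → IsCut N P (vertical s z) c A → A ⟨ k , i ⟩ → z * i ≡ 0
    column-content {k = k} A-cut Aki = m+n≡0⇒n≡0 (s ∸ k) (proj₁ (proj₁ (at A-cut k) Aki))

    module _ {b n} (b-cut : IsCut N P (vertical s z) [ n ] (W b)) where

      not-in-b : ∀ {k i} → n + s < k → ¬ W b ⟨ k , i ⟩
      not-in-b {k} n+s<k Wb with _ , [ k∸s≤n ] ← proj₁ (at b-cut k) Wb =
        <⇒≱ n+s<k (≤-trans (m≤n+m∸n k s)
          (≤-trans (+-monoʳ-≤ s k∸s≤n) (≤-reflexive (+-comm s n))))

      b-finite : z ≡ 1 → Finite (W b)
      b-finite refl = finite-⊆ em (map ⟨_, 0 ⟩ (upTo (suc (n + s)))) (⊆-on-pairs N P {W b} listed)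
        where
        listed : ∀ k i → W b ⟨ k , i ⟩ → ⟨ k , i ⟩ ∈ map ⟨_, 0 ⟩ (upTo (suc (n + s)))
        listed k i Wb with refl ← m+n≡0⇒m≡0 i (column-content b-cut Wb) =
          ∈-map⁺ _ (∈-upTo⁺ (s≤s (≮⇒≥ λ n+s<k → not-in-b n+s<k Wb)))

    module _ {a} (a-cut : IsCut N P (vertical s z) ⊤⁺ (W a)) where

      in-a : ∀ {k i} → s ≤ k → z * i ≡ 0 → W a ⟨ k , i ⟩
      in-a s≤k zi≡0 = in-column a-cut s≤k zi≡0 (_ ≤⊤⁺)

      a-infinite : Infinite (W a)
      a-infinite = injective⇒infinite (λ t → ⟨ s + t , 0 ⟩) (+-cancelˡ-≡ s _ _ ∘ row-injective)
        λ t → in-a (m≤m+n s t) (*-zeroʳ z)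

      module _ {b n} (b-cut : IsCut N P (vertical s z) [ n ] (W b)) where

        ¬E₁ : ¬ E₁ N P a b
        -- Beyond n + s the columns of b are empty, whereas those of a contain 0.
        ¬E₁ = injective⇒infinite (suc (n + s) +_) (+-cancelˡ-≡ (suc (n + s)) _ _)
          λ t a≐b → not-in-b b-cut (m≤m+n (suc (n + s)) t)
            (proj₁ a≐b (in-a (≤-trans (m≤n+m s (suc n)) (m≤m+n _ t)) (*-zeroʳ z)))

        ¬E₃ : z ≡ 0 → ¬ E₃ N P a b
        -- Column n + s + 1 is all of ω in a and empty in b.
        ¬E₃ refl E = injective⇒infinite id id
          (λ t → inj₁ (in-a (m≤n+m s (suc n)) refl , not-in-b b-cut ≤-refl)) (E (suc (n + s)))

        ¬Eset : s ≡ 0 → ¬ Eset N P a b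
        -- For s = 0 no column of a is empty, but column n + 1 of b is.
        ¬Eset refl (_ , b→a) with k , a≐b ← b→a (suc (n + s)) =
          not-in-b b-cut ≤-refl (proj₁ a≐b (in-a {i = 0} z≤n (*-zeroʳ z)))

    module _ {a e c} (a-cut : IsCut N P (vertical s z) ⊤⁺ (W a))
                     (e-cut : IsCut N P (vertical s z) c (W e)) where

      -- For z = 1 every column is contained in {0}.
      E₃-equivalent : z ≡ 1 → E₃ N P a e
      E₃-equivalent refl k = finite-⊆ em (0 ∷ []) only-0
        where
        only-0 : ∀ {i} → (column N P a k △ column N P e k) i → i ∈ 0 ∷ []
        only-0 {i} (inj₁ (Wa , _)) = here (m+n≡0⇒m≡0 i (column-content a-cut Wa))
        only-0 {i} (inj₂ (We , _)) = here (m+n≡0⇒m≡0 i (column-content e-cut We))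

      Emax-equivalent : z ≡ 0 → Emax N a e
      Emax-equivalent refl = inj₂ (inj₁ (infinite-cut a-cut , infinite-cut e-cut))
        where
        infinite-cut : ∀ {c A} → IsCut N P (vertical s 0) c A → Infinite A
        -- Column s has κ = 0, so it belongs to every cut, and for z = 0 it is all of ω.
        infinite-cut {c} A-cut = injective⇒infinite ⟨ s ,_⟩ column-injective
          λ i → in-column A-cut ≤-refl refl (subst (λ m → [ m ] ≤⁺ c) (sym (n∸n≡0 s)) (0≤⁺ c))

    module _ {c c′ A B} (A-cut : IsCut N P (vertical s z) c A) (B-cut : IsCut N P (vertical s z) c′ B) where

      full-columns : ∀ {k k′} → s ≤ k → [ k ∸ s ] ≤⁺ c → s ≤ k′ → [ k′ ∸ s ] ≤⁺ c′ →
        (λ i → A ⟨ k , i ⟩) ≐ (λ i → B ⟨ k′ , i ⟩)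
      full-columns s≤k k≤c s≤k′ k′≤c′ =
        (λ Ai → in-column B-cut s≤k′ (column-content A-cut Ai) k′≤c′) ,
        (λ Bi → in-column A-cut s≤k (column-content B-cut Bi) k≤c)

      empty-columns : ∀ {k k′} → ¬ (s ≤ k × [ k ∸ s ] ≤⁺ c) → ¬ (s ≤ k′ × [ k′ ∸ s ] ≤⁺ c′) →
        (λ i → A ⟨ k , i ⟩) ≐ (λ i → B ⟨ k′ , i ⟩)
      empty-columns {k} {k′} out out′ =
        (λ Ai → contradiction (column-start A-cut Ai , proj₂ (proj₁ (at A-cut k) Ai)) out) ,
        (λ Bi → contradiction (column-start B-cut Bi , proj₂ (proj₁ (at B-cut k′) Bi)) out′)

  -- Only two sets occur as columns, the empty one and a fixed nonempty one. The start s = 1 gives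
  -- every cut both: column 0 is empty, column 1 is not.
  Eset-equivalent : ∀ {z a e c} → IsCut N P (vertical 1 z) ⊤⁺ (W a) →
    IsCut N P (vertical 1 z) c (W e) → Eset N P a e
  Eset-equivalent {z} {a} {e} {c} a-cut e-cut = a→e , e→a
    where
    open Vertical 1 z
    before : ∀ {c} → ¬ (1 ≤ 0 × [ 0 ] ≤⁺ c)
    before ()
    a→e : ∀ k → ∃ λ k′ → column N P a k ≐ column N P e k′
    a→e zero    = 0 , empty-columns a-cut e-cut before before
    a→e (suc k) = 1 , full-columns a-cut e-cut z<s (_ ≤⊤⁺) z<s (0≤⁺ c)
    e→a : ∀ k′ → ∃ λ k → column N P a k ≐ column N P e k′
    e→a zero    = 0 , empty-columns a-cut e-cut before before
    -- A column of e past the cut is empty and is matched with column 0 of a.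
    e→a (suc k) with ≤⁺-dec _≤?_ [ k ] c
    ... | yes k≤c = 1 , full-columns a-cut e-cut z<s (_ ≤⊤⁺) z<s k≤c
    ... | no  k≰c = 0 , empty-columns a-cut e-cut before (k≰c ∘ proj₂)

-- The twelve non-reductions

theorem5p8 : ExcludedMiddle 0ℓ →
    (N : AcceptableNumbering) (P : ComputablePairing) →
    AllPairs (Incomparable N) (E₁ N P ∷ E₃ N P ∷ Eset N P ∷ Emax N ∷ [])
theorem5p8 em N P =
  ((E₁≰E₃ , E₃≰E₁) ∷ (E₁≰Eset , Eset≰E₁) ∷ (E₁≰Emax , Emax≰E₁) ∷ []) ∷
  ((E₃≰Eset , Eset≰E₃) ∷ (E₃≰Emax , Emax≰E₃) ∷ []) ∷
  ((Eset≰Emax , Emax≰Eset) ∷ []) ∷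
  [] ∷ []
  where
  module E₁-family = Horizontal em N P
  module E₃-family = Vertical em N P 0 1
  module Eset-family = Vertical em N P 1 0
  module Eset-row-family = Vertical em N P 1 1
  module Emax-family = Vertical em N P 0 0

  separate : ∀ G {E F} → _
  separate G {E} {F} = cuts-separate N P G em {E} {F}

  infix 4 _≰_
  _≰_ : Rel ℕ 0ℓ → Rel ℕ 0ℓ → Set₁
  E ≰ F = ¬ _≤Learn_ N E F

  E₁≰E₃ : E₁ N P ≰ E₃ N P
  E₁≰E₃ = separate horizontal E₁-family.E₁-equivalent
    λ a-cut b-cut Eia Eib → E₁-family.¬E₃ a-cut b-cut (E₃-euclidean N P em Eia Eib)
  E₁≰Eset : E₁ N P ≰ Eset N P
  E₁≰Eset = separate horizontal E₁-family.E₁-equivalent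
    λ a-cut b-cut Eia Eib → E₁-family.¬Eset a-cut b-cut (Eset-euclidean N P Eia Eib)
  E₁≰Emax : E₁ N P ≰ Emax N
  E₁≰Emax = separate horizontal E₁-family.E₁-equivalent
    λ a-cut b-cut → Emax-separated em N P (E₁-family.a-infinite a-cut) (E₁-family.b-finite b-cut)

  E₃≰E₁ : E₃ N P ≰ E₁ N P
  E₃≰E₁ = separate (vertical 0 1) (λ a-cut e-cut → E₃-family.E₃-equivalent a-cut e-cut refl)
    λ a-cut b-cut Eia Eib → E₃-family.¬E₁ a-cut b-cut (E₁-euclidean N P em Eia Eib)
  E₃≰Eset : E₃ N P ≰ Eset N P
  E₃≰Eset = separate (vertical 0 1) (λ a-cut e-cut → E₃-family.E₃-equivalent a-cut e-cut refl)
    λ a-cut b-cut Eia Eib → E₃-family.¬Eset a-cut b-cut refl (Eset-euclidean N P Eia Eib)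
  E₃≰Emax : E₃ N P ≰ Emax N
  E₃≰Emax = separate (vertical 0 1) (λ a-cut e-cut → E₃-family.E₃-equivalent a-cut e-cut refl)
    λ a-cut b-cut → Emax-separated em N P (E₃-family.a-infinite a-cut) (E₃-family.b-finite b-cut refl)

  Eset≰E₁ : Eset N P ≰ E₁ N P
  Eset≰E₁ = separate (vertical 1 0) (Eset-equivalent em N P)
    λ a-cut b-cut Eia Eib → Eset-family.¬E₁ a-cut b-cut (E₁-euclidean N P em Eia Eib)
  Eset≰E₃ : Eset N P ≰ E₃ N P
  Eset≰E₃ = separate (vertical 1 0) (Eset-equivalent em N P)
    λ a-cut b-cut Eia Eib → Eset-family.¬E₃ a-cut b-cut refl (E₃-euclidean N P em Eia Eib)
  Eset≰Emax : Eset N P ≰ Emax N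
  -- Columns equal to {0} keep the cuts finite, so that `Emax` tells them from the infinite limit
  -- set.
  Eset≰Emax = separate (vertical 1 1) (Eset-equivalent em N P)
    λ a-cut b-cut → Emax-separated em N P (Eset-row-family.a-infinite a-cut) (Eset-row-family.b-finite b-cut refl)

  Emax≰E₁ : Emax N ≰ E₁ N P
  Emax≰E₁ = separate (vertical 0 0) (λ a-cut e-cut → Emax-family.Emax-equivalent a-cut e-cut refl)
    λ a-cut b-cut Eia Eib → Emax-family.¬E₁ a-cut b-cut (E₁-euclidean N P em Eia Eib)
  Emax≰E₃ : Emax N ≰ E₃ N P
  Emax≰E₃ = separate (vertical 0 0) (λ a-cut e-cut → Emax-family.Emax-equivalent a-cut e-cut refl)
    λ a-cut b-cut Eia Eib → Emax-family.¬E₃ a-cut b-cut refl (E₃-euclidean N P em Eia Eib)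
  Emax≰Eset : Emax N ≰ Eset N P
  Emax≰Eset = separate (vertical 0 0) (λ a-cut e-cut → Emax-family.Emax-equivalent a-cut e-cut refl)
    λ a-cut b-cut Eia Eib → Emax-family.¬Eset a-cut b-cut refl (Eset-euclidean N P Eia Eib)
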